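{- Let $p$ be an odd prime, let $0<s<p-1$ be an integer, and let $0<a,a'<p$ be integers with $a'\equiv sa\pmod p$. Then $b_{1,s}(a)=0$ in $\mathbb F_p$ (evaluating at $a$ viewed as an element of $\mathbb F_p$) if and only if $a+a'<p$.
   Context: $\mathbb F_p$ is the field of $p$ elements, $\alpha$ an indeterminate, $\binom{x}{m}=x(x-1)\cdots(x-m+1)/m!$. For integers $0<r,s<p$ (interpreted as elements of $\mathbb F_p$), $b_{r,s}(\alpha)=\sum_{k=0}^{p-1}(-r/s)^k\binom{r\alpha-1}{p-1-k}\binom{s\alpha-1}{k}\in\mathbb F_p[\alpha]$. -}

module Defs where

open import Algebra.Bundles using (CommutativeRing; RawRing; Semiring)
import Algebra.Definitions.RawMonoid as RawMonoidDefs
import Algebra.Definitions.RawSemiring as RawSemiringDefs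
open import Data.Fin.Base using (toℕ)
open import Data.Integer.Base as ℤ using (ℤ; +_; -[1+_]; 0ℤ; 1ℤ; _+_; _*_; _-_; -_; ∣_∣)
import Data.Integer.Properties as ℤ
open import Data.Integer.Divisibility.Signed as ℤ∣ using (_∣_; divides)
open import Data.Integer.Tactic.RingSolver using (solve-∀)
open import Data.List.Base using (List; []; _∷_; map)
open import Data.Nat.Base as ℕ using (ℕ; zero; suc; _∸_; _!)
import Data.Nat.Divisibility as ℕ∣
open import Data.Nat.GCD using (module Bézout; module GCD)
open import Data.Nat.Primality using (Prime; prime⇒irreducible)
open import Data.Product.Base using (∃; _,_; _×_; proj₁; proj₂)
open import Data.Sum.Base using (inj₁; inj₂)
open import Level using (0ℓ)
open import Relation.Binary.Definitions using (Decidable)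
open import Relation.Binary.PropositionalEquality
  using (_≡_; refl; sym; trans; cong; subst)
open import Relation.Nullary using (¬_; yes; no; contradiction)
import Relation.Nullary.Decidable as Dec

-- A polynomial is the list of its coefficients, constant term first.
-- Trailing zeros are allowed, so equality is coefficientwise.
module Polynomial {c ℓ} (R : CommutativeRing c ℓ) where
  open CommutativeRing R
    using (Carrier; _≈_; 0#; 1#) renaming (_+_ to _⊕_; _*_ to _⊛_; -_ to ⊖_)

  Poly : Set c
  Poly = List Carrier

  coeff : Poly → ℕ → Carrier
  coeff []      _       = 0#
  coeff (x ∷ f) zero    = x
  coeff (x ∷ f) (suc n) = coeff f n

  infix 4 _≈ᴾ_
  _≈ᴾ_ : Poly → Poly → Set ℓ
  f ≈ᴾ g = ∀ n → coeff f n ≈ coeff g n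

  infixl 6 _+ᴾ_ _-ᴾ_
  infixl 7 _*ᴾ_

  _+ᴾ_ : Poly → Poly → Poly
  []      +ᴾ g       = g
  (x ∷ f) +ᴾ []      = x ∷ f
  (x ∷ f) +ᴾ (y ∷ g) = (x ⊕ y) ∷ (f +ᴾ g)

  -ᴾ_ : Poly → Poly
  -ᴾ_ = map ⊖_

  _-ᴾ_ : Poly → Poly → Poly
  f -ᴾ g = f +ᴾ (-ᴾ g)

  _*ᴾ_ : Poly → Poly → Poly
  []      *ᴾ g = []
  (x ∷ f) *ᴾ g = map (x ⊛_) g +ᴾ (0# ∷ (f *ᴾ g))

  constant : Carrier → Poly
  constant x = x ∷ []

  α : Poly
  α = 0# ∷ 1# ∷ []

  rawRing : RawRing c ℓ
  rawRing = record
    { Carrier = Poly ; _≈_ = _≈ᴾ_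
    ; _+_ = _+ᴾ_ ; _*_ = _*ᴾ_ ; -_ = -ᴾ_
    ; 0# = [] ; 1# = constant 1#
    }

  open RawMonoidDefs (RawRing.+-rawMonoid rawRing) public using (sum)

  eval : Poly → Carrier → Carrier
  eval []      t = 0#
  eval (x ∷ f) t = x ⊕ t ⊛ eval f t

infix 4 _≡_[mod_]

record _≡_[mod_] (x y : ℤ) (n : ℕ) : Set where
  constructor modulo
  field difference : + n ∣ x - y

-- Carrier ℤ, with congruence modulo n as its equality.
ℤ/ : ℕ → CommutativeRing 0ℓ 0ℓ
ℤ/ n = record
  { Carrier = ℤ ; _≈_ = _≡_[mod n ]
  ; _+_ = _+_ ; _*_ = _*_ ; -_ = -_ ; 0# = 0ℤ ; 1# = 1ℤ
  ; isCommutativeRing = record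
    { isRing = record
      { +-isAbelianGroup = record
        { isGroup = record
          { isMonoid = record
            { isSemigroup = record
              { isMagma = record
                { isEquivalence = record
                  { refl  = reflexive refl
                  ; sym   = λ {x} {y} (modulo d) → modulo
                      (subst (+ n ∣_) (sym-eq x y) (ℤ∣.∣m⇒∣-m d))
                  ; trans = λ {x} {y} {z} (modulo d) (modulo e) → modulo
                      (subst (+ n ∣_) (trans-eq x y z) (ℤ∣.∣m∣n⇒∣m+n d e))
                  }
                ; ∙-cong = λ {x} {y} {u} {v} (modulo d) (modulo e) → modulo
                    (subst (+ n ∣_) (+-eq x y u v) (ℤ∣.∣m∣n⇒∣m+n d e))
                }
              ; assoc = λ x y z → reflexive (ℤ.+-assoc x y z)
              }
            ; identity = (λ x → reflexive (ℤ.+-identityˡ x))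
                       , (λ x → reflexive (ℤ.+-identityʳ x))
            }
          ; inverse = (λ x → reflexive (ℤ.+-inverseˡ x))
                    , (λ x → reflexive (ℤ.+-inverseʳ x))
          ; ⁻¹-cong = λ {x} {y} (modulo d) → modulo
              (subst (+ n ∣_) (neg-eq x y) (ℤ∣.∣m⇒∣-m d))
          }
        ; comm = λ x y → reflexive (ℤ.+-comm x y)
        }
      ; *-cong = λ {x} {y} {u} {v} (modulo d) (modulo e) → modulo
          (subst (+ n ∣_) (*-eq x y u v)
            (ℤ∣.∣m∣n⇒∣m+n (ℤ∣.∣m⇒∣m*n u d) (ℤ∣.∣n⇒∣m*n y e)))
      ; *-assoc = λ x y z → reflexive (ℤ.*-assoc x y z)
      ; *-identity = (λ x → reflexive (ℤ.*-identityˡ x))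
                   , (λ x → reflexive (ℤ.*-identityʳ x))
      ; distrib = (λ x y z → reflexive (ℤ.*-distribˡ-+ x y z))
                , (λ x y z → reflexive (ℤ.*-distribʳ-+ x y z))
      }
    ; *-comm = λ x y → reflexive (ℤ.*-comm x y)
    }
  }
  where
  reflexive : ∀ {x y} → x ≡ y → x ≡ y [mod n ]
  reflexive {x} refl = modulo (divides 0ℤ (ℤ.+-inverseʳ x))

  sym-eq : ∀ x y → - (x - y) ≡ y - x
  sym-eq = solve-∀
  trans-eq : ∀ x y z → (x - y) + (y - z) ≡ x - z
  trans-eq = solve-∀
  +-eq : ∀ x y u v → (x - y) + (u - v) ≡ (x + u) - (y + v)
  +-eq = solve-∀
  neg-eq : ∀ x y → - (x - y) ≡ (- x) - (- y)
  neg-eq = solve-∀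
  *-eq : ∀ x y u v → (x - y) * u + y * (u - v) ≡ x * u - y * v
  *-eq = solve-∀

module 𝔽 (p : ℕ) (p-prime : Prime p) where

  open CommutativeRing (ℤ/ p) public
    using (_≈_; 0#; 1#)
  open RawSemiringDefs (Semiring.rawSemiring (CommutativeRing.semiring (ℤ/ p))) public
    using (_^_)

  private module R = CommutativeRing (ℤ/ p)

  infix 4 _≈?_
  _≈?_ : Decidable _≈_
  x ≈? y = Dec.map′ modulo _≡_[mod_].difference (+ p ℤ∣.∣? (x - y))

  private
    coprime : ∀ {x} → ¬ x ≈ 0# → GCD.GCD ∣ x ∣ p 1
    coprime {x} x≉0 = GCD.is (ℕ∣.1∣ _ , ℕ∣.1∣ p) greatest
      where
      greatest : ∀ {d} → d ℕ∣.∣ ∣ x ∣ × d ℕ∣.∣ p → d ℕ∣.∣ 1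
      greatest (d∣x , d∣p) with prime⇒irreducible p-prime d∣p
      ... | inj₁ refl = ℕ∣.∣-refl
      ... | inj₂ refl = contradiction
        (modulo (subst (+ p ∣_) (sym (ℤ.+-identityʳ x)) (ℤ∣.∣ᵤ⇒∣ d∣x))) x≉0

    pos-linear : ∀ u v w → + (u ℕ.+ v ℕ.* w) ≡ + u + + v * + w
    pos-linear u v w = cong (λ t → + u + t) (ℤ.pos-* v w)

    invertible-abs : ∀ {x} → ¬ x ≈ 0# → ∃ λ y → + ∣ x ∣ * y ≈ 1#
    invertible-abs {x} x≉0 with Bézout.identity (coprime x≉0)
    ... | Bézout.+- u v eq = + u , modulo (divides (+ v)
          (trans (cong (_- 1ℤ)
                   (trans (ℤ.*-comm (+ ∣ x ∣) (+ u))
                   (trans (sym (ℤ.pos-* u ∣ x ∣))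
                   (trans (cong +_ (sym eq)) (pos-linear 1 v p)))))
                 (lemma (+ v * + p))))
      where
      lemma : ∀ t → (1ℤ + t) - 1ℤ ≡ t
      lemma = solve-∀
    ... | Bézout.-+ u v eq = - (+ u) , modulo (divides (- (+ v))
          (trans (lemma (+ ∣ x ∣) (+ u))
          (trans (cong -_
                   (trans (sym (pos-linear 1 u ∣ x ∣))
                   (trans (cong +_ eq) (ℤ.pos-* v p))))
                 (ℤ.neg-distribˡ-* (+ v) (+ p)))))
      where
      lemma : ∀ t w → t * (- w) - 1ℤ ≡ - (1ℤ + w * t)
      lemma = solve-∀

  invertible : ∀ {x} → ¬ x ≈ 0# → ∃ λ y → x * y ≈ 1#
  invertible {x = + _} x≉0 = invertible-abs x≉0
  invertible {x = -[1+ n ]} x≉0 with invertible-abs x≉0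
  ... | y , eq = - y , subst (_≈ 1#) (lemma (+ suc n) y) eq
    where
    lemma : ∀ t y → t * y ≡ (- t) * (- y)
    lemma = solve-∀

  infix 8 _⁻¹

  -- Totalised by 0⁻¹ = 0.
  _⁻¹ : ℤ → ℤ
  x ⁻¹ with x ≈? 0#
  ... | yes _   = 0#
  ... | no  x≉0 = proj₁ (invertible x≉0)

  ⁻¹-inverseʳ : ∀ {x} → ¬ x ≈ 0# → x * x ⁻¹ ≈ 1#
  ⁻¹-inverseʳ {x} x≉0 with x ≈? 0#
  ... | yes x≈0 = contradiction x≈0 x≉0
  ... | no  x≉0 = proj₂ (invertible x≉0)

  ⁻¹-cong : ∀ {x y} → x ≈ y → x ⁻¹ ≈ y ⁻¹
  ⁻¹-cong {x} {y} x≈y with x ≈? 0# | y ≈? 0#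
  ... | yes _   | yes _   = R.refl
  ... | yes x≈0 | no  y≉0 = contradiction (R.trans (R.sym x≈y) x≈0) y≉0
  ... | no  x≉0 | yes y≈0 = contradiction (R.trans x≈y y≈0) x≉0
  ... | no  x≉0 | no  y≉0 with invertible x≉0 | invertible y≉0
  ...   | u , xu≈1 | v , yv≈1 = begin
    u           ≈⟨ R.*-identityʳ u ⟨
    u * 1#      ≈⟨ R.*-congˡ {u} yv≈1 ⟨
    u * (y * v) ≈⟨ R.*-congˡ {u} (R.*-congʳ {v} x≈y) ⟨
    u * (x * v) ≈⟨ R.*-assoc u x v ⟨
    u * x * v   ≈⟨ R.*-congʳ {v} (R.*-comm u x) ⟩
    x * u * v   ≈⟨ R.*-congʳ {v} xu≈1 ⟩
    1# * v      ≈⟨ R.*-identityˡ v ⟩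
    v           ∎
    where open import Relation.Binary.Reasoning.Setoid R.setoid

  open Polynomial (ℤ/ p) public

  fallingFactorial : Poly → ℕ → Poly
  fallingFactorial f zero    = constant 1#
  fallingFactorial f (suc m) = fallingFactorial f m *ᴾ (f -ᴾ constant (+ m))

  -- Meaningful for m < p, where m! is invertible modulo p.
  binomial : Poly → ℕ → Poly
  binomial f m = fallingFactorial f m *ᴾ constant ((+ (m !)) ⁻¹)

  -- Here sum ranges over k : Fin p.
  b : ℕ → ℕ → Poly
  b r s = sum {p} λ i → let k = toℕ i in
    constant ((- (+ r * (+ s) ⁻¹)) ^ k)
      *ᴾ binomial (constant (+ r) *ᴾ α -ᴾ constant 1#) (p ∸ 1 ∸ k)
      *ᴾ binomial (constant (+ s) *ᴾ α -ᴾ constant 1#) k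

{-# OPTIONS --safe #-}

-- Put m = a − 1, n = a′ − 1, N = p − 1 and d = −1/s.  Then b₁ₛ(a) is the
-- coefficient of xᴺ in (1 + x)ᵐ (1 + d x)ⁿ.  Expanding the second factor through
-- 1 + d x = (1 − d) + d (1 + x) makes it Σⱼ C(n,j) (1 − d)ⁿ⁻ʲ dʲ C(m+j,N), and
-- C(i,N) vanishes modulo p for all i ≤ 2N other than N.  Only the term with
-- j = p − a survives, and it is nonzero exactly when p − a ≤ n.

module Submission where

open import Defs
open import Algebra.Bundles using (CommutativeRing)
import Algebra.Properties.CommutativeMonoid.Sum as CommutativeMonoidSum
import Algebra.Properties.CommutativeSemigroup as CommutativeSemigroupProperties
import Algebra.Properties.Monoid.Sum as MonoidSum
import Algebra.Properties.Ring as RingProperties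
import Algebra.Properties.Semiring.Sum as SemiringSum
open import Data.Fin.Base as Fin using (Fin; toℕ)
open import Data.Fin.Properties using (toℕ<n)
open import Data.Integer.Base as ℤ using (ℤ; +_; 0ℤ; 1ℤ; _^_)
import Data.Integer.Divisibility.Signed as ℤ∣
import Data.Integer.Properties as ℤ
open import Data.Integer.Tactic.RingSolver using (solve-∀)
open import Data.List.Base using ([]; _∷_; map)
open import Data.Nat.Base as ℕ using (ℕ; zero; suc; _+_; _*_; _∸_; _<_; _≤_; _!; s≤s)
open import Data.Nat.Combinatorics
  using (_C_; nCn≡1; k>n⇒nCk≡0; k![n∸k]!∣n!; nCk≡n!/k![n-k]!; nCk+nC[k+1]≡[n+1]C[k+1])
open import Data.Nat.Divisibility using (_∣_; ∣-refl; ∣-trans; >⇒∤; m∣m*n; ∣m⇒∣m*n; m≤n⇒m!∣n!)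
open import Data.Nat.DivMod using (m/n*n≡m)
open import Data.Nat.Primality using (Prime; euclidsLemma; prime⇒nonTrivial)
import Data.Nat.Properties as ℕ
open import Data.Product.Base using (_,_)
open import Data.Sum.Base as Sum using (_⊎_; inj₁; inj₂)
open import Function.Base using (_∘_)
open import Function.Bundles using (_⇔_; mk⇔; Equivalence)
import Relation.Binary.Reasoning.Setoid as SetoidReasoning
open import Relation.Binary.PropositionalEquality
  using (_≡_; refl; sym; trans; cong; cong₂; subst; module ≡-Reasoning)
open import Relation.Nullary using (¬_; yes; no; contradiction)

-- Evaluation at a point as a ring homomorphism

module Evaluation {c ℓ} (R : CommutativeRing c ℓ) where
  open CommutativeRing R
    renaming (_+_ to _⊕_; _*_ to _⊛_; -_ to ⊖_; refl to ≈-refl; sym to ≈-sym; trans to ≈-trans)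
  open RingProperties ring using (-0#≈0#; -‿distribʳ-*; -‿+-comm)
  open CommutativeSemigroupProperties +-commutativeSemigroup using (interchange)
  open CommutativeSemigroupProperties *-commutativeSemigroup using (x∙yz≈y∙xz)
  open Polynomial R hiding (sum)
  open MonoidSum +-monoid using (sum)
  open SetoidReasoning setoid

  private module P = Polynomial R

  eval-constant : ∀ x t → eval (constant x) t ≈ x
  eval-constant x t = ≈-trans (+-congˡ (zeroʳ t)) (+-identityʳ x)

  eval-α : ∀ t → eval α t ≈ t
  eval-α t = begin
    0# ⊕ t ⊛ eval (constant 1#) t ≈⟨ +-identityˡ _ ⟩
    t ⊛ eval (constant 1#) t      ≈⟨ *-congˡ (eval-constant 1# t) ⟩
    t ⊛ 1#                        ≈⟨ *-identityʳ t ⟩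
    t                             ∎

  eval-+ : ∀ f g t → eval (f +ᴾ g) t ≈ eval f t ⊕ eval g t
  eval-+ []      g       t = ≈-sym (+-identityˡ _)
  eval-+ (x ∷ f) []      t = ≈-sym (+-identityʳ _)
  eval-+ (x ∷ f) (y ∷ g) t = begin
    (x ⊕ y) ⊕ t ⊛ eval (f +ᴾ g) t        ≈⟨ +-congˡ (*-congˡ (eval-+ f g t)) ⟩
    (x ⊕ y) ⊕ t ⊛ (eval f t ⊕ eval g t)  ≈⟨ +-congˡ (distribˡ t _ _) ⟩
    (x ⊕ y) ⊕ (t ⊛ eval f t ⊕ t ⊛ eval g t) ≈⟨ interchange x y _ _ ⟩
    (x ⊕ t ⊛ eval f t) ⊕ (y ⊕ t ⊛ eval g t) ∎

  eval-scale : ∀ x f t → eval (map (x ⊛_) f) t ≈ x ⊛ eval f t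
  eval-scale x []      t = ≈-sym (zeroʳ x)
  eval-scale x (y ∷ f) t = begin
    x ⊛ y ⊕ t ⊛ eval (map (x ⊛_) f) t ≈⟨ +-congˡ (*-congˡ (eval-scale x f t)) ⟩
    x ⊛ y ⊕ t ⊛ (x ⊛ eval f t)        ≈⟨ +-congˡ (x∙yz≈y∙xz t x _) ⟩
    x ⊛ y ⊕ x ⊛ (t ⊛ eval f t)        ≈⟨ distribˡ x y _ ⟨
    x ⊛ (y ⊕ t ⊛ eval f t)            ∎

  eval-neg : ∀ f t → eval (-ᴾ f) t ≈ ⊖ eval f t
  eval-neg []      t = ≈-sym -0#≈0#
  eval-neg (x ∷ f) t = begin
    ⊖ x ⊕ t ⊛ eval (-ᴾ f) t ≈⟨ +-congˡ (*-congˡ (eval-neg f t)) ⟩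
    ⊖ x ⊕ t ⊛ ⊖ eval f t    ≈⟨ +-congˡ (-‿distribʳ-* t _) ⟨
    ⊖ x ⊕ ⊖ (t ⊛ eval f t)  ≈⟨ -‿+-comm x _ ⟩
    ⊖ (x ⊕ t ⊛ eval f t)    ∎

  eval-- : ∀ f g t → eval (f -ᴾ g) t ≈ eval f t ⊕ ⊖ eval g t
  eval-- f g t = ≈-trans (eval-+ f (-ᴾ g) t) (+-congˡ (eval-neg g t))

  eval-* : ∀ f g t → eval (f *ᴾ g) t ≈ eval f t ⊛ eval g t
  eval-* []      g t = ≈-sym (zeroˡ _)
  eval-* (x ∷ f) g t = begin
    eval (map (x ⊛_) g +ᴾ (0# ∷ f *ᴾ g)) t
      ≈⟨ eval-+ (map (x ⊛_) g) (0# ∷ f *ᴾ g) t ⟩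
    eval (map (x ⊛_) g) t ⊕ (0# ⊕ t ⊛ eval (f *ᴾ g) t)
      ≈⟨ +-cong (eval-scale x g t) (≈-trans (+-identityˡ _) (*-congˡ (eval-* f g t))) ⟩
    x ⊛ eval g t ⊕ t ⊛ (eval f t ⊛ eval g t)
      ≈⟨ +-congˡ (*-assoc t _ _) ⟨
    x ⊛ eval g t ⊕ (t ⊛ eval f t) ⊛ eval g t
      ≈⟨ distribʳ (eval g t) x _ ⟨
    (x ⊕ t ⊛ eval f t) ⊛ eval g t ∎

  eval-sum : ∀ {n} (f : Fin n → Poly) t → eval (P.sum f) t ≈ sum (λ i → eval (f i) t)
  eval-sum {zero}  f t = ≈-refl
  eval-sum {suc n} f t =
    ≈-trans (eval-+ (f Fin.zero) (P.sum (f ∘ Fin.suc)) t) (+-congˡ (eval-sum (f ∘ Fin.suc) t))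

-- Falling factorials and binomial coefficients

falling : ℤ → ℕ → ℤ
falling x zero    = 1ℤ
falling x (suc k) = falling x k ℤ.* (x ℤ.- + k)

-- Pulling the first factor out of the left side leaves (1 + x) · `falling x k`, and 1 + x = (x - k)
-- + (k + 1). Since `falling` is built by its last factor, this takes an induction on `k`.
falling-pascal : ∀ x k →
  falling (1ℤ ℤ.+ x) (suc k) ≡ falling x (suc k) ℤ.+ + suc k ℤ.* falling x k
falling-pascal x zero = base x
  where
  base : ∀ x → 1ℤ ℤ.* (1ℤ ℤ.+ x ℤ.- 0ℤ) ≡ 1ℤ ℤ.* (x ℤ.- 0ℤ) ℤ.+ 1ℤ ℤ.* 1ℤ
  base = solve-∀
falling-pascal x (suc k) = begin
  falling (1ℤ ℤ.+ x) (suc k) ℤ.* (1ℤ ℤ.+ x ℤ.- + suc k)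
    ≡⟨ cong (ℤ._* (1ℤ ℤ.+ x ℤ.- + suc k)) (falling-pascal x k) ⟩
  (f ℤ.* (x ℤ.- + k) ℤ.+ + suc k ℤ.* f) ℤ.* (1ℤ ℤ.+ x ℤ.- + suc k)
    ≡⟨ step f x (+ k) ⟩
  f ℤ.* (x ℤ.- + k) ℤ.* (x ℤ.- + suc k) ℤ.+ + suc (suc k) ℤ.* (f ℤ.* (x ℤ.- + k)) ∎
  where
  open ≡-Reasoning
  f = falling x k
  step : ∀ f x k →
    (f ℤ.* (x ℤ.- k) ℤ.+ (1ℤ ℤ.+ k) ℤ.* f) ℤ.* (1ℤ ℤ.+ x ℤ.- (1ℤ ℤ.+ k)) ≡
    f ℤ.* (x ℤ.- k) ℤ.* (x ℤ.- (1ℤ ℤ.+ k)) ℤ.+ (1ℤ ℤ.+ (1ℤ ℤ.+ k)) ℤ.* (f ℤ.* (x ℤ.- k))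
  step = solve-∀

falling-0 : ∀ k → falling 0ℤ (suc k) ≡ 0ℤ
falling-0 zero    = refl
falling-0 (suc k) = cong (ℤ._* (0ℤ ℤ.- + suc k)) (falling-0 k)

-- Both sides satisfy the same Pascal recursion. The division-free form holds over ℤ for all `k`, so
-- it can be reduced modulo p before k! is cancelled.
falling≡C*! : ∀ n k → falling (+ n) k ≡ + (n C k) ℤ.* + (k !)
falling≡C*! n       zero    = refl
falling≡C*! zero    (suc k) = falling-0 k
falling≡C*! (suc n) (suc k) = begin
  falling (+ suc n) (suc k)
    ≡⟨ falling-pascal (+ n) k ⟩
  falling (+ n) (suc k) ℤ.+ + suc k ℤ.* falling (+ n) k
    ≡⟨ cong₂ (λ u v → u ℤ.+ + suc k ℤ.* v) (falling≡C*! n (suc k)) (falling≡C*! n k) ⟩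
  + (n C suc k) ℤ.* + (suc k * k !) ℤ.+ + suc k ℤ.* (+ (n C k) ℤ.* + (k !))
    ≡⟨ cong (λ u → + (n C suc k) ℤ.* u ℤ.+ + suc k ℤ.* (+ (n C k) ℤ.* + (k !)))
            (ℤ.pos-* (suc k) (k !)) ⟩
  + (n C suc k) ℤ.* (+ suc k ℤ.* + (k !)) ℤ.+ + suc k ℤ.* (+ (n C k) ℤ.* + (k !))
    ≡⟨ rearrange (+ (n C suc k)) (+ suc k) (+ (k !)) (+ (n C k)) ⟩
  (+ (n C k) ℤ.+ + (n C suc k)) ℤ.* (+ suc k ℤ.* + (k !))
    ≡⟨ cong₂ (λ u v → + u ℤ.* v) (nCk+nC[k+1]≡[n+1]C[k+1] n k) (sym (ℤ.pos-* (suc k) (k !))) ⟩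
  + (suc n C suc k) ℤ.* + (suc k !) ∎
  where
  open ≡-Reasoning
  rearrange : ∀ u s f v → u ℤ.* (s ℤ.* f) ℤ.+ s ℤ.* (v ℤ.* f) ≡ (v ℤ.+ u) ℤ.* (s ℤ.* f)
  rearrange = solve-∀

nCk*k![n∸k]!≡n! : ∀ {n k} → k ≤ n → (n C k) * (k ! * (n ∸ k) !) ≡ n !
nCk*k![n∸k]!≡n! {n} {k} k≤n =
  trans (cong (_* (k ! * (n ∸ k) !)) (nCk≡n!/k![n-k]! k≤n)) (m/n*n≡m (k![n∸k]!∣n! k≤n))
  where instance _ = k ℕ.!* (n ∸ k) !≢0

-- Divisibility of factorials and binomial coefficients by p

module _ {p} (p-prime : Prime p) where

  prime∤! : ∀ {n} → n < p → ¬ p ∣ n !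
  prime∤! {zero}  n<p p∣1 = >⇒∤ (ℕ.nonTrivial⇒n>1 p) p∣1
    where instance _ = prime⇒nonTrivial p-prime
  prime∤! {suc n} n<p p∣n! with euclidsLemma (suc n) (n !) p-prime p∣n!
  ... | inj₁ p∣n = >⇒∤ n<p p∣n
  ... | inj₂ p∣! = prime∤! (ℕ.<⇒≤ n<p) p∣!

  prime∣! : ∀ {n} → p ≤ n → p ∣ n !
  prime∣! {n} p≤n = ∣-trans (p∣p! p-prime) (m≤n⇒m!∣n! p≤n)
    where
    p∣p! : ∀ {p} → Prime p → p ∣ p !
    p∣p! {suc p} _ = m∣m*n (p !)
    p∣p! {zero} 0-prime = contradiction (ℕ.nonTrivial⇒n>1 0 {{prime⇒nonTrivial 0-prime}}) λ ()

  -- C(n,k) divides n!, whose factors are all positive and below p.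
  prime∤C : ∀ {n k} → k ≤ n → n < p → ¬ p ∣ n C k
  prime∤C {n} {k} k≤n n<p p∣C =
    prime∤! n<p (subst (p ∣_) (nCk*k![n∸k]!≡n! k≤n) (∣m⇒∣m*n (k ! * (n ∸ k) !) p∣C))

  -- In C(n,k) · k! · (n - k)! = n!, p divides the right side but neither factorial on the left.
  prime∣C : ∀ {n k} → k < p → n ∸ k < p → p ≤ n → p ∣ n C k
  prime∣C {n} {k} k<p n∸k<p p≤n
    with euclidsLemma (n C k) (k ! * (n ∸ k) !) p-prime
           (subst (p ∣_) (sym (nCk*k![n∸k]!≡n! (ℕ.≤-trans (ℕ.<⇒≤ k<p) p≤n))) (prime∣! p≤n))
  ... | inj₁ p∣C = p∣C
  ... | inj₂ p∣! with euclidsLemma (k !) ((n ∸ k) !) p-prime p∣!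
  ...   | inj₁ p∣k!     = contradiction p∣k! (prime∤! k<p)
  ...   | inj₂ p∣[n∸k]! = contradiction p∣[n∸k]! (prime∤! n∸k<p)

-- The coefficient of xᴺ in (1 + x)ᵐ (1 + d x)ⁿ

module _ (d : ℤ) where
  open SemiringSum ℤ.+-*-semiring using (sum; *-distribˡ-sum; sum-cong-≗; sum-replicate-zero)
  open CommutativeMonoidSum ℤ.+-0-commutativeMonoid using (∑-distrib-+)

  -- The arguments are n, m and N in this order. The recursion on `n` multiplies by one factor 1 + d
  -- x at a time, so identities between products of polynomials become inductions on `n`.
  coefficient : ℕ → ℕ → ℕ → ℤ
  coefficient zero    m N       = + (m C N)
  coefficient (suc n) m zero    = coefficient n m zero
  coefficient (suc n) m (suc N) = coefficient n m (suc N) ℤ.+ d ℤ.* coefficient n m N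

  private
    term : ℕ → ℕ → ℕ → ℕ → ℤ
    term n m N k = d ^ k ℤ.* + (m C (N ∸ k)) ℤ.* + (n C k)

    convolution : ℕ → ℕ → ℕ → ℤ
    convolution n m N = sum {suc N} (term n m N ∘ toℕ)

    convolution-0 : ∀ m N → convolution 0 m N ≡ + (m C N)
    convolution-0 m N = begin
      1ℤ ℤ.* + (m C N) ℤ.* 1ℤ ℤ.+ sum {N} (λ i → term 0 m N (suc (toℕ i)))
        ≡⟨ cong₂ ℤ._+_ (units (+ (m C N)))
             (trans (sum-cong-≗ {N} λ i → ℤ.*-zeroʳ (d ^ suc (toℕ i) ℤ.* + (m C (N ∸ suc (toℕ i)))))
                    (sum-replicate-zero N)) ⟩
      + (m C N) ℤ.+ 0ℤ ≡⟨ ℤ.+-identityʳ _ ⟩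
      + (m C N)        ∎
      where
      open ≡-Reasoning
      units : ∀ x → 1ℤ ℤ.* x ℤ.* 1ℤ ≡ x
      units = solve-∀

    -- Pascal's rule on C(n + 1, k + 1) splits every term after the head. The C(n,k) parts form d
    -- times the convolution of degree N; the C(n, k + 1) parts rejoin the head, which is the same
    -- for `n` and `suc n` because a binomial coefficient with lower index 0 computes to 1.
    convolution-suc : ∀ n m N →
      convolution (suc n) m (suc N) ≡ convolution n m (suc N) ℤ.+ d ℤ.* convolution n m N
    convolution-suc n m N = begin
      h ℤ.+ sum {suc N} (λ i → term (suc n) m (suc N) (suc (toℕ i)))
        ≡⟨ cong (λ u → h ℤ.+ u) (sum-cong-≗ {suc N} (split ∘ toℕ)) ⟩
      h ℤ.+ sum {suc N} (λ i → d ℤ.* term n m N (toℕ i) ℤ.+ term n m (suc N) (suc (toℕ i)))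
        ≡⟨ cong (λ u → h ℤ.+ u) (∑-distrib-+ {suc N} (λ i → d ℤ.* term n m N (toℕ i))
             (λ i → term n m (suc N) (suc (toℕ i)))) ⟩
      h ℤ.+ (sum {suc N} (λ i → d ℤ.* term n m N (toℕ i)) ℤ.+ tail)
        ≡⟨ cong (λ u → h ℤ.+ (u ℤ.+ tail)) (*-distribˡ-sum {suc N} d (term n m N ∘ toℕ)) ⟨
      h ℤ.+ (d ℤ.* convolution n m N ℤ.+ tail)
        ≡⟨ rearrange h _ tail ⟩
      h ℤ.+ tail ℤ.+ d ℤ.* convolution n m N ∎
      where
      open ≡-Reasoning
      h    = term n m (suc N) 0
      tail = sum {suc N} (λ i → term n m (suc N) (suc (toℕ i)))
      rearrange : ∀ u v w → u ℤ.+ (v ℤ.+ w) ≡ u ℤ.+ w ℤ.+ v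
      rearrange = solve-∀
      distribute : ∀ d e c x y →
        d ℤ.* e ℤ.* c ℤ.* (x ℤ.+ y) ≡ d ℤ.* (e ℤ.* c ℤ.* x) ℤ.+ d ℤ.* e ℤ.* c ℤ.* y
      distribute = solve-∀
      split : ∀ k → term (suc n) m (suc N) (suc k) ≡
                    d ℤ.* term n m N k ℤ.+ term n m (suc N) (suc k)
      split k = trans
        (cong (λ u → d ^ suc k ℤ.* + (m C (N ∸ k)) ℤ.* + u) (sym (nCk+nC[k+1]≡[n+1]C[k+1] n k)))
        (distribute d (d ^ k) (+ (m C (N ∸ k))) (+ (n C k)) (+ (n C suc k)))

  -- Both sides obey the same recursion in `n`. The left side is the sum defining `b` once its
  -- binomials have been evaluated.
  sum≡coefficient : ∀ n m N →
    sum {suc N} (λ i → d ^ toℕ i ℤ.* + (m C (N ∸ toℕ i)) ℤ.* + (n C toℕ i)) ≡ coefficient n m N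
  sum≡coefficient zero    m N       = convolution-0 m N
  sum≡coefficient (suc n) m zero    = sum≡coefficient n m zero
  sum≡coefficient (suc n) m (suc N) = trans (convolution-suc n m N)
    (cong₂ (λ u v → u ℤ.+ d ℤ.* v) (sum≡coefficient n m (suc N)) (sum≡coefficient n m N))

  -- This is multiplication by the other factor, 1 + x, which the definition does not recurse on. It
  -- commutes with multiplication by 1 + d x, so induction on `n` reduces it to Pascal's rule for
  -- C(m,N).
  coefficient-pascal : ∀ n m N →
    coefficient n (suc m) (suc N) ≡ coefficient n m N ℤ.+ coefficient n m (suc N)
  coefficient-pascal zero    m N       = cong +_ (sym (nCk+nC[k+1]≡[n+1]C[k+1] m N))
  coefficient-pascal (suc n) m zero    = trans
    (cong₂ (λ u v → u ℤ.+ d ℤ.* v) (coefficient-pascal n m zero) (constant-term n))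
    (ℤ.+-assoc (coefficient n m 0) (coefficient n m 1) (d ℤ.* coefficient n m 0))
    where
    constant-term : ∀ n → coefficient n (suc m) 0 ≡ coefficient n m 0
    constant-term zero    = refl
    constant-term (suc n) = constant-term n
  coefficient-pascal (suc n) m (suc N) = trans
    (cong₂ (λ u v → u ℤ.+ d ℤ.* v) (coefficient-pascal n m (suc N)) (coefficient-pascal n m N))
    (rearrange (coefficient n m (suc N)) (coefficient n m (suc (suc N))) d (coefficient n m N))
    where
    rearrange : ∀ x y d z →
      x ℤ.+ y ℤ.+ d ℤ.* (z ℤ.+ x) ≡ x ℤ.+ d ℤ.* z ℤ.+ (y ℤ.+ d ℤ.* x)
    rearrange = solve-∀

  -- 1 + d x = (1 − d) + d (1 + x)
  coefficient-shift : ∀ n m N →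
    coefficient (suc n) m (suc N) ≡
    (1ℤ ℤ.- d) ℤ.* coefficient n m (suc N) ℤ.+ d ℤ.* coefficient n (suc m) (suc N)
  coefficient-shift n m N = trans
    (rearrange (coefficient n m (suc N)) d (coefficient n m N))
    (cong (λ u → (1ℤ ℤ.- d) ℤ.* coefficient n m (suc N) ℤ.+ d ℤ.* u)
          (sym (coefficient-pascal n m N)))
    where
    rearrange : ∀ x d z → x ℤ.+ d ℤ.* z ≡ (1ℤ ℤ.- d) ℤ.* x ℤ.+ d ℤ.* (z ℤ.+ x)
    rearrange = solve-∀

-- Arithmetic modulo p

module ModPrime {p} (p-prime : Prime p) where
  private module 𝔽p = 𝔽 p p-prime
  open 𝔽p hiding (_^_; sum)
  open CommutativeRing (ℤ/ p) using (*-cong; *-congˡ; +-cong; -‿cong; setoid; reflexive)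
    renaming (trans to ≈-trans)
  open Evaluation (ℤ/ p)
  open SetoidReasoning setoid

  ∣⇒≈0 : ∀ {x} → p ∣ ℤ.∣ x ∣ → x ≈ 0#
  ∣⇒≈0 {x} p∣x = modulo (subst (+ p ℤ∣.∣_) (sym (ℤ.+-identityʳ x)) (ℤ∣.∣ᵤ⇒∣ p∣x))

  ≈0⇒∣ : ∀ {x} → x ≈ 0# → p ∣ ℤ.∣ x ∣
  ≈0⇒∣ {x} (modulo p∣x) = ℤ∣.∣⇒∣ᵤ (subst (+ p ℤ∣.∣_) (ℤ.+-identityʳ x) p∣x)

  *≈0⇒ : ∀ x y → x ℤ.* y ≈ 0# → x ≈ 0# ⊎ y ≈ 0#
  *≈0⇒ x y xy≈0 = Sum.map ∣⇒≈0 ∣⇒≈0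
    (euclidsLemma ℤ.∣ x ∣ ℤ.∣ y ∣ p-prime (subst (p ∣_) (ℤ.abs-* x y) (≈0⇒∣ xy≈0)))

  *≉0 : ∀ {x y} → ¬ x ≈ 0# → ¬ y ≈ 0# → ¬ x ℤ.* y ≈ 0#
  *≉0 {x} {y} x≉0 y≉0 xy≈0 with *≈0⇒ x y xy≈0
  ... | inj₁ x≈0 = x≉0 x≈0
  ... | inj₂ y≈0 = y≉0 y≈0

  1≉0 : ¬ 1# ≈ 0#
  1≉0 1≈0 = >⇒∤ (ℕ.nonTrivial⇒n>1 p) (≈0⇒∣ 1≈0)
    where instance _ = prime⇒nonTrivial p-prime

  ^≉0 : ∀ {x} k → ¬ x ≈ 0# → ¬ x ^ k ≈ 0#
  ^≉0 zero    x≉0 = 1≉0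
  ^≉0 (suc k) x≉0 = *≉0 x≉0 (^≉0 k x≉0)

  eval-fallingFactorial : ∀ {f t x} k → eval f t ≈ x → eval (fallingFactorial f k) t ≈ falling x k
  eval-fallingFactorial {t = t} zero f≈x = eval-constant 1# t
  eval-fallingFactorial {f} {t} {x} (suc k) f≈x = begin
    eval (fallingFactorial f k *ᴾ (f -ᴾ constant (+ k))) t
      ≈⟨ eval-* (fallingFactorial f k) (f -ᴾ constant (+ k)) t ⟩
    eval (fallingFactorial f k) t ℤ.* eval (f -ᴾ constant (+ k)) t
      ≈⟨ *-cong (eval-fallingFactorial k f≈x)
           (≈-trans (eval-- f (constant (+ k)) t) (+-cong f≈x (-‿cong (eval-constant (+ k) t)))) ⟩
    falling x k ℤ.* (x ℤ.- + k) ∎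

  -- The k! supplied by `falling≡C*!` cancels the inverse in `binomial`; `k < p` makes k! a unit, so
  -- that `⁻¹` is a true inverse there.
  eval-binomial : ∀ {f t n k} → k < p → eval f t ≈ + n → eval (binomial f k) t ≈ + (n C k)
  eval-binomial {f} {t} {n} {k} k<p f≈n = begin
    eval (fallingFactorial f k *ᴾ constant ((+ (k !)) ⁻¹)) t
      ≈⟨ eval-* (fallingFactorial f k) (constant ((+ (k !)) ⁻¹)) t ⟩
    eval (fallingFactorial f k) t ℤ.* eval (constant ((+ (k !)) ⁻¹)) t
      ≈⟨ *-cong (≈-trans (eval-fallingFactorial k f≈n) (reflexive (falling≡C*! n k)))
                (eval-constant ((+ (k !)) ⁻¹) t) ⟩
    + (n C k) ℤ.* + (k !) ℤ.* (+ (k !)) ⁻¹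
      ≡⟨ ℤ.*-assoc (+ (n C k)) (+ (k !)) ((+ (k !)) ⁻¹) ⟩
    + (n C k) ℤ.* (+ (k !) ℤ.* (+ (k !)) ⁻¹)
      ≈⟨ *-congˡ {+ (n C k)} (⁻¹-inverseʳ {+ (k !)} (prime∤! p-prime k<p ∘ ≈0⇒∣)) ⟩
    + (n C k) ℤ.* 1#
      ≡⟨ ℤ.*-identityʳ _ ⟩
    + (n C k) ∎

  eval-linear : ∀ x t → eval (constant x *ᴾ α -ᴾ constant 1#) t ≈ x ℤ.* t ℤ.- 1ℤ
  eval-linear x t = ≈-trans (eval-- (constant x *ᴾ α) (constant 1#) t)
    (+-cong (≈-trans (eval-* (constant x) α t) (*-cong (eval-constant x t) (eval-α t)))
            (-‿cong (eval-constant 1# t)))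


  -- `b` is stated with the generic semiring power, `coefficient` is treated with the integer power.
  pow≡^ : ∀ x k → x 𝔽p.^ k ≡ x ^ k
  pow≡^ x zero    = refl
  pow≡^ x (suc k) = cong (x ℤ.*_) (pow≡^ x k)

-- Values of `b` as coefficients modulo p

module _ {M} (p-prime : Prime (suc (suc M))) where
  -- With p = `suc (suc M)`, the degree `N` is itself a successor, the shape that
  -- `coefficient-shift` requires.
  private
    N p : ℕ
    N = suc M
    p = suc N

  private module 𝔽p = 𝔽 p p-prime
  open 𝔽p hiding (_^_; sum)
  open CommutativeRing (ℤ/ p) using (+-monoid; *-cong; *-congˡ; +-cong; +-congʳ; setoid; reflexive)
    renaming (refl to ≈-refl; sym to ≈-sym; trans to ≈-trans)
  open Evaluation (ℤ/ p)
  open MonoidSum +-monoid using (sum; sum-cong-≋)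
  open ModPrime p-prime
  open SetoidReasoning setoid

  -- Natural representatives `m` and `n` of rt - 1 and st - 1 turn the polynomial binomials into
  -- ordinary ones; their lower indices are at most `N`, hence below p.
  eval-b : ∀ r s t {m n} → + r ℤ.* t ℤ.- 1ℤ ≈ + m → + s ℤ.* t ℤ.- 1ℤ ≈ + n →
    eval (b r s) t ≈ coefficient (ℤ.- (+ r ℤ.* (+ s) ⁻¹)) n m N
  eval-b r s t {m} {n} rt-1≈m st-1≈n = begin
    eval (b r s) t
      ≈⟨ eval-sum {p} (summand ∘ toℕ) t ⟩
    sum {p} (λ i → eval (summand (toℕ i)) t)
      ≈⟨ sum-cong-≋ {p} (λ i → eval-summand (toℕ<n i)) ⟩
    sum {p} (λ i → d ^ toℕ i ℤ.* + (m C (N ∸ toℕ i)) ℤ.* + (n C toℕ i))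
      ≡⟨ sum≡coefficient d n m N ⟩
    coefficient d n m N ∎
    where
    d = ℤ.- (+ r ℤ.* (+ s) ⁻¹)
    linear : ℕ → Poly
    linear x = constant (+ x) *ᴾ α -ᴾ constant 1#
    power : ℕ → Poly
    power k = constant (d 𝔽p.^ k)
    summand : ℕ → Poly
    summand k = power k *ᴾ binomial (linear r) (N ∸ k) *ᴾ binomial (linear s) k
    eval-summand : ∀ {k} → k < p →
      eval (summand k) t ≈ d ^ k ℤ.* + (m C (N ∸ k)) ℤ.* + (n C k)
    eval-summand {k} k<p = begin
      eval (summand k) t
        ≈⟨ eval-* (power k *ᴾ binomial (linear r) (N ∸ k)) (binomial (linear s) k) t ⟩
      eval (power k *ᴾ binomial (linear r) (N ∸ k)) t ℤ.* eval (binomial (linear s) k) t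
        ≈⟨ *-cong (≈-trans (eval-* (power k) (binomial (linear r) (N ∸ k)) t)
             (*-cong (≈-trans (eval-constant (d 𝔽p.^ k) t) (reflexive (pow≡^ d k)))
                     (eval-binomial (s≤s (ℕ.m∸n≤m N k)) (≈-trans (eval-linear (+ r) t) rt-1≈m))))
             (eval-binomial k<p (≈-trans (eval-linear (+ s) t) st-1≈n)) ⟩
      d ^ k ℤ.* + (m C (N ∸ k)) ℤ.* + (n C k) ∎

  -- Closed form and vanishing of the coefficient modulo p

  module _ (d : ℤ) where
    private e = 1ℤ ℤ.- d

    -- Each shift keeps m or raises it by one, so only C(i,N) with p ≤ i ≤ 2N arise. The upper bound
    -- keeps i - N below p, and then p divides C(i,N).
    coefficient-vanishes : ∀ {m} n → p ≤ m → n + m ≤ N + N → coefficient d n m N ≈ 0#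
    coefficient-vanishes {m} zero    p≤m m≤2N =
      ∣⇒≈0 (prime∣C p-prime ℕ.≤-refl (s≤s (ℕ.m≤n+o⇒m∸n≤o m N m≤2N)) p≤m)
    coefficient-vanishes {m} (suc n) p≤m 1+n+m≤2N = begin
      coefficient d (suc n) m N
        ≡⟨ coefficient-shift d n m M ⟩
      e ℤ.* coefficient d n m N ℤ.+ d ℤ.* coefficient d n (suc m) N
        ≈⟨ +-cong (*-congˡ {e} (coefficient-vanishes n p≤m (ℕ.<⇒≤ 1+n+m≤2N)))
                  (*-congˡ {d} (coefficient-vanishes n (ℕ.m≤n⇒m≤1+n p≤m)
                    (subst (_≤ N + N) (sym (ℕ.+-suc n m)) 1+n+m≤2N))) ⟩
      e ℤ.* 0# ℤ.+ d ℤ.* 0#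
        ≡⟨ cong₂ ℤ._+_ (ℤ.*-zeroʳ e) (ℤ.*-zeroʳ d) ⟩
      0# ∎

    -- Here `j` counts the raises needed to bring m up to N. Among the n shifts, those raising m
    -- contribute d and the others e = 1 - d; ending below N gives 0 as C(m,N) = 0, and ending above
    -- N gives 0 modulo p, so exactly j raises count.
    coefficient≈ : ∀ n j {m} → n ≤ N → j + m ≡ N →
      coefficient d n m N ≈ + (n C j) ℤ.* (e ^ (n ∸ j) ℤ.* d ^ j)
    coefficient≈ zero zero n≤N refl = reflexive (cong +_ (nCn≡1 N))
    coefficient≈ zero (suc j) {m} n≤N refl = reflexive (cong +_ (k>n⇒nCk≡0 (s≤s (ℕ.m≤n+m m j))))
    coefficient≈ (suc n) zero n<N refl = begin
      coefficient d (suc n) N N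
        ≡⟨ coefficient-shift d n N M ⟩
      e ℤ.* coefficient d n N N ℤ.+ d ℤ.* coefficient d n p N
        ≈⟨ +-cong (*-congˡ {e} (coefficient≈ n 0 (ℕ.<⇒≤ n<N) refl))
                  -- Raising m = N once more gives p; `suc n ≤ N` supplies the bound n + p ≤ 2N.
                  (*-congˡ {d} (coefficient-vanishes n ℕ.≤-refl
                    (subst (_≤ N + N) (sym (ℕ.+-suc n N)) (ℕ.+-monoˡ-≤ N n<N)))) ⟩
      e ℤ.* (1ℤ ℤ.* (e ^ n ℤ.* 1ℤ)) ℤ.+ d ℤ.* 0#
        ≡⟨ rearrange e (e ^ n) d ⟩
      1ℤ ℤ.* (e ℤ.* e ^ n ℤ.* 1ℤ) ∎
      where
      rearrange : ∀ e u d →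
        e ℤ.* (1ℤ ℤ.* (u ℤ.* 1ℤ)) ℤ.+ d ℤ.* 0ℤ ≡ 1ℤ ℤ.* (e ℤ.* u ℤ.* 1ℤ)
      rearrange = solve-∀
    coefficient≈ (suc n) (suc j) {m} n<N 1+j+m≡N = begin
      coefficient d (suc n) m N
        ≡⟨ coefficient-shift d n m M ⟩
      e ℤ.* coefficient d n m N ℤ.+ d ℤ.* coefficient d n (suc m) N
        ≈⟨ +-cong (*-congˡ {e} (coefficient≈ n (suc j) (ℕ.<⇒≤ n<N) 1+j+m≡N))
                  (*-congˡ {d} (coefficient≈ n j (ℕ.<⇒≤ n<N) (trans (ℕ.+-suc j m) 1+j+m≡N))) ⟩
      e ℤ.* (+ (n C suc j) ℤ.* (e ^ (n ∸ suc j) ℤ.* d ^ suc j)) ℤ.+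
      d ℤ.* (+ (n C j) ℤ.* (e ^ (n ∸ j) ℤ.* d ^ j))
        ≡⟨ gather e d (+ (n C suc j)) (e ^ (n ∸ suc j)) (d ^ j) (+ (n C j)) (e ^ (n ∸ j)) ⟩
      + (n C suc j) ℤ.* (e ℤ.* e ^ (n ∸ suc j)) ℤ.* (d ℤ.* d ^ j) ℤ.+
      + (n C j) ℤ.* e ^ (n ∸ j) ℤ.* (d ℤ.* d ^ j)
        ≡⟨ cong (λ u → u ℤ.* (d ℤ.* d ^ j) ℤ.+ + (n C j) ℤ.* e ^ (n ∸ j) ℤ.* (d ℤ.* d ^ j))
                absorb ⟩
      + (n C suc j) ℤ.* e ^ (n ∸ j) ℤ.* (d ℤ.* d ^ j) ℤ.+
      + (n C j) ℤ.* e ^ (n ∸ j) ℤ.* (d ℤ.* d ^ j)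
        ≡⟨ factor (+ (n C suc j)) (+ (n C j)) (e ^ (n ∸ j)) (d ^ suc j) ⟩
      (+ (n C j) ℤ.+ + (n C suc j)) ℤ.* (e ^ (n ∸ j) ℤ.* d ^ suc j)
        ≡⟨ cong (λ u → + u ℤ.* (e ^ (n ∸ j) ℤ.* d ^ suc j)) (nCk+nC[k+1]≡[n+1]C[k+1] n j) ⟩
      + (suc n C suc j) ℤ.* (e ^ (n ∸ j) ℤ.* d ^ suc j) ∎
      where
      gather : ∀ e d x u v y w →
        e ℤ.* (x ℤ.* (u ℤ.* (d ℤ.* v))) ℤ.+ d ℤ.* (y ℤ.* (w ℤ.* v)) ≡
        x ℤ.* (e ℤ.* u) ℤ.* (d ℤ.* v) ℤ.+ y ℤ.* w ℤ.* (d ℤ.* v)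
      gather = solve-∀
      factor : ∀ x y u v → x ℤ.* u ℤ.* v ℤ.+ y ℤ.* u ℤ.* v ≡ (y ℤ.+ x) ℤ.* (u ℤ.* v)
      factor = solve-∀
      -- For j ≥ n the exponents disagree, but then C(n, j + 1) = 0.
      absorb : + (n C suc j) ℤ.* (e ℤ.* e ^ (n ∸ suc j)) ≡ + (n C suc j) ℤ.* e ^ (n ∸ j)
      absorb with j ℕ.<? n
      ... | yes j<n = cong (λ k → + (n C suc j) ℤ.* e ^ k) (sym (ℕ.+-∸-assoc 1 j<n))
      ... | no  j≮n rewrite k>n⇒nCk≡0 {n} {suc j} (s≤s (ℕ.≮⇒≥ j≮n)) =
        trans (ℤ.*-zeroˡ (e ℤ.* e ^ (n ∸ suc j))) (sym (ℤ.*-zeroˡ (e ^ (n ∸ j))))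

    -- The powers of d and e in the closed form are units, so C(n,j) decides: it is 0 for n < j, and
    -- prime to p for j ≤ n because n < p.
    coefficient≈0⇔ : ¬ d ≈ 0# → ¬ e ≈ 0# → ∀ {n j m} → n ≤ N → j + m ≡ N →
      coefficient d n m N ≈ 0# ⇔ n < j
    coefficient≈0⇔ d≉0 e≉0 {n} {j} {m} n≤N j+m≡N = mk⇔ to from
      where
      closed = coefficient≈ n j n≤N j+m≡N
      to : coefficient d n m N ≈ 0# → n < j
      to c≈0 with n ℕ.<? j
      ... | yes n<j = n<j
      ... | no  n≮j = contradiction (≈-trans (≈-sym closed) c≈0)
        (*≉0 {+ (n C j)} (prime∤C p-prime (ℕ.≮⇒≥ n≮j) (s≤s n≤N) ∘ ≈0⇒∣)
             (*≉0 {e ^ (n ∸ j)} (^≉0 (n ∸ j) e≉0) (^≉0 {d} j d≉0)))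
      from : n < j → coefficient d n m N ≈ 0#
      from n<j = ≈-trans closed
        (reflexive (cong (λ c → + c ℤ.* (e ^ (n ∸ j) ℤ.* d ^ j)) (k>n⇒nCk≡0 n<j)))

  -- The specialisation r = 1, d = -1/s

  -1/s≉0 : ∀ {s i} → s ℤ.* i ≈ 1# → ¬ ℤ.- (1ℤ ℤ.* i) ≈ 0#
  -1/s≉0 {s} {i} si≈1 d≈0 = 1≉0 (begin
    1#                            ≈⟨ si≈1 ⟨
    s ℤ.* i                       ≡⟨ rearrange s i ⟩
    ℤ.- s ℤ.* ℤ.- (1ℤ ℤ.* i)      ≈⟨ *-congˡ {ℤ.- s} d≈0 ⟩
    ℤ.- s ℤ.* 0#                  ≡⟨ ℤ.*-zeroʳ (ℤ.- s) ⟩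
    0#                            ∎)
    where
    rearrange : ∀ s i → s ℤ.* i ≡ ℤ.- s ℤ.* ℤ.- (1ℤ ℤ.* i)
    rearrange = solve-∀

  -- Since s (1 - d) = s + 1, the exclusion of s = p - 1 is what keeps 1 - d a unit. The factor `1ℤ`
  -- is the `+ r` in the definition of `b`.
  1+1/s≉0 : ∀ {s i} → s ℤ.* i ≈ 1# → ¬ 1ℤ ℤ.+ s ≈ 0# → ¬ 1ℤ ℤ.- ℤ.- (1ℤ ℤ.* i) ≈ 0#
  1+1/s≉0 {s} {i} si≈1 1+s≉0 e≈0 = 1+s≉0 (begin
    1ℤ ℤ.+ s                         ≈⟨ +-congʳ {s} si≈1 ⟨
    s ℤ.* i ℤ.+ s                    ≡⟨ rearrange s i ⟩
    s ℤ.* (1ℤ ℤ.- ℤ.- (1ℤ ℤ.* i))    ≈⟨ *-congˡ {s} e≈0 ⟩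
    s ℤ.* 0#                         ≡⟨ ℤ.*-zeroʳ s ⟩
    0#                               ∎)
    where
    rearrange : ∀ s i → s ℤ.* i ℤ.+ s ≡ s ℤ.* (1ℤ ℤ.- ℤ.- (1ℤ ℤ.* i))
    rearrange = solve-∀

  coefficient[-1/s]≈0⇔ : ∀ {s i m n} → s ℤ.* i ≈ 1# → ¬ 1ℤ ℤ.+ s ≈ 0# → m ≤ N → n ≤ N →
    coefficient (ℤ.- (1ℤ ℤ.* i)) n m N ≈ 0# ⇔ n < N ∸ m
  coefficient[-1/s]≈0⇔ {s} {i} si≈1 1+s≉0 m≤N n≤N =
    coefficient≈0⇔ (ℤ.- (1ℤ ℤ.* i)) (-1/s≉0 {s} si≈1) (1+1/s≉0 {s} {i} si≈1 1+s≉0)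
      n≤N (ℕ.m∸n+n≡m m≤N)

  -- With a = `suc m` and a′ = `suc n`, a + a′ ≡ (1 + s) a modulo p, and both factors lie strictly
  -- between 0 and p. This closes the gap between a + a′ ≤ p and a + a′ < p.
  a+a′≢p : ∀ {s m n} → suc s < p → m < N → + suc n ≈ + (s * suc m) → ¬ suc m + suc n ≡ p
  a+a′≢p {s} {m} {n} 1+s<p m<N a′≈sa a+a′≡p =
    Sum.[ >⇒∤ 1+s<p , >⇒∤ (s≤s m<N) ]
      (euclidsLemma (suc s) (suc m) p-prime (≈0⇒∣ {+ (suc s * suc m)} [1+s]a≈0))
    where
    [1+s]a≈0 : + (suc s * suc m) ≈ 0#
    [1+s]a≈0 = begin
      + suc m ℤ.+ + (s * suc m) ≈⟨ +-cong (≈-refl {+ suc m}) a′≈sa ⟨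
      + (suc m + suc n)         ≡⟨ cong +_ a+a′≡p ⟩
      + p                       ≈⟨ ∣⇒≈0 {+ p} ∣-refl ⟩
      0#                        ∎

  b≈coefficient : ∀ s {m n} → + suc n ≈ + (s * suc m) →
    eval (b 1 s) (+ suc m) ≈ coefficient (ℤ.- (1ℤ ℤ.* (+ s) ⁻¹)) n m N
  b≈coefficient s {m} {n} a′≈sa = eval-b 1 s (+ suc m) (reflexive (a-1≡m (+ m))) sa-1≈n
    where
    a-1≡m : ∀ m → 1ℤ ℤ.* (1ℤ ℤ.+ m) ℤ.- 1ℤ ≡ m
    a-1≡m = solve-∀
    1+x-1≡x : ∀ x → 1ℤ ℤ.+ x ℤ.- 1ℤ ≡ x
    1+x-1≡x = solve-∀
    sa-1≈n : + s ℤ.* + suc m ℤ.- 1ℤ ≈ + n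
    sa-1≈n = begin
      + s ℤ.* + suc m ℤ.- 1ℤ ≡⟨ cong (ℤ._- 1ℤ) (ℤ.pos-* s (suc m)) ⟨
      + (s * suc m) ℤ.- 1ℤ   ≈⟨ +-congʳ {ℤ.- 1ℤ} a′≈sa ⟨
      + suc n ℤ.- 1ℤ         ≡⟨ 1+x-1≡x (+ n) ⟩
      + n                    ∎

  b≈0⇔ : ∀ {s m n} → 0 < s → suc s < p → m < N → n < N → + suc n ≈ + (s * suc m) →
    eval (b 1 s) (+ suc m) ≈ 0# ⇔ suc m + suc n < p
  b≈0⇔ {s} {m} {n} 0<s 1+s<p m<N n<N a′≈sa = mk⇔ to from
    where
    m≤N : m ≤ N
    m≤N = ℕ.<⇒≤ m<N

    s≉0 : ¬ + s ≈ 0#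
    s≉0 s≈0 = >⇒∤ {{ℕ.>-nonZero 0<s}} (ℕ.<-trans (ℕ.n<1+n s) 1+s<p) (≈0⇒∣ {+ s} s≈0)

    1+s≉0 : ¬ 1ℤ ℤ.+ + s ≈ 0#
    1+s≉0 1+s≈0 = >⇒∤ 1+s<p (≈0⇒∣ {+ suc s} 1+s≈0)

    coefficient≈0⇔n<j : coefficient (ℤ.- (1ℤ ℤ.* (+ s) ⁻¹)) n m N ≈ 0# ⇔ n < N ∸ m
    coefficient≈0⇔n<j =
      coefficient[-1/s]≈0⇔ {+ s} {(+ s) ⁻¹} (⁻¹-inverseʳ {+ s} s≉0) 1+s≉0 m≤N (ℕ.<⇒≤ n<N)

    to : eval (b 1 s) (+ suc m) ≈ 0# → suc m + suc n < p
    -- The criterion n < N - m says only a + a′ ≤ p; equality is excluded separately.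
    to b≈0 = ℕ.≤∧≢⇒< (s≤s a+a′-1≤N) (a+a′≢p {s} 1+s<p m<N a′≈sa)
      where
      a+a′-1≤N : m + suc n ≤ N
      a+a′-1≤N = subst (_≤ N) (ℕ.+-comm (suc n) m) (ℕ.m≤o∸n⇒m+n≤o (suc n) m≤N
        (Equivalence.to coefficient≈0⇔n<j (≈-trans (≈-sym (b≈coefficient s a′≈sa)) b≈0)))

    from : suc m + suc n < p → eval (b 1 s) (+ suc m) ≈ 0#
    -- The hypothesis is one stronger than the criterion, so it is weakened by one here.
    from (s≤s a+a′≤N) = ≈-trans (b≈coefficient s a′≈sa) (Equivalence.from coefficient≈0⇔n<j
      (ℕ.m+n≤o⇒m≤o∸n (suc n) (subst (_≤ N) (ℕ.+-comm m (suc n)) (ℕ.<⇒≤ a+a′≤N))))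

theorem12 : (p : ℕ) (p-prime : Prime p) → ¬ (2 ∣ p) →
    (s : ℕ) → 0 < s → s < p ∸ 1 →
    (a a′ : ℕ) → 0 < a → a < p → 0 < a′ → a′ < p →
    + a′ ≡ + (s * a) [mod p ] →
    let open 𝔽 p p-prime in
    (eval (b 1 s) (+ a) ≈ 0#) ⇔ (a + a′ < p)
-- `s < p ∸ 1` excludes p < 2. From here on `m` and `n` are a - 1 and a′ - 1.
theorem12 (suc (suc M)) p-prime _ s 0<s s<N (suc m) (suc n) _ (s≤s m<N) _ (s≤s n<N) a′≈sa =
  b≈0⇔ p-prime 0<s (s≤s s<N) m<N n<N a′≈sa
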